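{- Let $f,g:\{0,1\}^n\to\{0,1\}$ be Boolean functions and let $K$ be a nonnegative integer. If $f$ is PN-equivalent to $g$, then $|E({}^K\!SG^1(f))|=|E({}^K\!SG^1(g))|$.
   Context: For a word $x=(x_1,\dots,x_n)\in\{0,1\}^n$ and an index $i$, $x^i$ denotes the word obtained from $x$ by changing (flipping) its $i$-th bit. The (local) sensitivity of $f$ on $x$ is $s(f,x)=|\{i\in\{1,\dots,n\}: f(x)\neq f(x^i)\}|$. $Q_n$ is the $n$-dimensional hypercube graph: its vertices are the words in $\{0,1\}^n$, and two words are adjacent if and only if they differ in exactly one bit. The $K$-1-sensitivity graph ${}^K\!SG^1(f)$ is the induced subgraph of $Q_n$ on the vertex set $\{x\in\{0,1\}^n: s(f,x)=K, f(x)=1\}$, and $|E({}^K\!SG^1(f))|$ denotes its number of edges. PN-equivalence: $f$ is PN-equivalent to $g$ if there exist a permutation $\pi$ of the $n$ coordinates (acting on words by permuting their bits) and, for each coordinate $j$, a choice of whether or not to negate it (written $(\neg)x_j$, the choice being independent of $x$), such that $f(\pi((\neg)x_1,(\neg)x_2,\dots,(\neg)x_n))=g(x_1,\dots,x_n)$ for all $x\in\{0,1\}^n$. -}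

module Defs where

open import Data.Bool.Base using (Bool; true; false; not; _xor_)
open import Data.Bool.Properties using () renaming (_≟_ to _≟ᵇ_)
open import Data.Fin.Base using (Fin)
open import Data.Fin.Permutation using (Permutation′; _⟨$⟩ʳ_)
open import Data.List.Base using (List; []; _∷_; _++_; map; filter; length; cartesianProductWith)
open import Data.List.Membership.Propositional using (_∈_)
open import Data.List.Membership.Propositional.Properties using (∈-cartesianProductWith⁺)
open import Data.List.Relation.Unary.All using ([]; _∷_)
open import Data.List.Relation.Unary.AllPairs using ([]; _∷_)
open import Data.List.Relation.Unary.Any using (here; there)
open import Data.List.Relation.Unary.Unique.Propositional using (Unique)
import Data.List.Relation.Unary.Unique.Propositional.Properties as Unique
open import Data.Nat.Base using (ℕ; zero; suc)
open import Data.Nat.Properties using () renaming (_≟_ to _≟ⁿ_)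
open import Data.Product.Base using (Σ; _×_; _,_; uncurry)
open import Data.Vec.Base using (Vec; []; _∷_; lookup; tabulate; allFin; count; zipWith; _[_]%=_)
open import Data.Vec.Properties using (∷-injective)
open import Relation.Binary.Core using (Rel)
import Relation.Binary.Definitions as B
open import Relation.Binary.PropositionalEquality using (_≡_; refl; sym; trans; cong)
open import Relation.Nullary using (¬_; yes; no; contradiction)
open import Relation.Nullary.Decidable using (¬?; _×-dec_)
import Relation.Unary as U
open import Level using (0ℓ)

-- The vertex set is a duplicate-free list, so that its elements can be
-- counted; adjacency of elements of V outside the list is irrelevant.
record FiniteGraph (V : Set) : Set₁ where
  field
    vertices : List V
    unique   : Unique vertices
    _~_      : Rel V 0ℓ
    _~?_     : B.Decidable _~_
    ~-sym    : B.Symmetric _~_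
    ~-irrefl : ∀ {x} → ¬ (x ~ x)

open FiniteGraph

inducedSubgraph : ∀ {V} → FiniteGraph V → {P : U.Pred V 0ℓ} → U.Decidable P → FiniteGraph V
inducedSubgraph G P? = record
  { vertices = filter P? (vertices G)
  ; unique   = Unique.filter⁺ P? (unique G)
  ; _~_      = _~_ G
  ; _~?_     = _~?_ G
  ; ~-sym    = ~-sym G
  ; ~-irrefl = ~-irrefl G
  }

-- On a duplicate-free list, every two-element subset {x , y} is listed
-- exactly once, in only one of its two orders.
unorderedPairs : ∀ {A : Set} → List A → List (A × A)
unorderedPairs []       = []
unorderedPairs (x ∷ xs) = map (x ,_) xs ++ unorderedPairs xs

edges : ∀ {V} → FiniteGraph V → List (V × V)
edges G = filter (uncurry (_~?_ G)) (unorderedPairs (vertices G))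

∣E_∣ : ∀ {V} → FiniteGraph V → ℕ
∣E G ∣ = length (edges G)

Word : ℕ → Set
Word n = Vec Bool n

BoolFun : ℕ → Set
BoolFun n = Word n → Bool

allWords : ∀ n → List (Word n)
allWords zero    = [] ∷ []
allWords (suc n) = cartesianProductWith _∷_ (false ∷ true ∷ []) (allWords n)

allWords-unique : ∀ n → Unique (allWords n)
allWords-unique zero    = [] ∷ []
allWords-unique (suc n) = Unique.cartesianProductWith⁺ _∷_ ∷-injective
  (((λ ()) ∷ []) ∷ [] ∷ []) (allWords-unique n)

allWords-complete : ∀ {n} (x : Word n) → x ∈ allWords n
allWords-complete []          = here refl
allWords-complete (false ∷ x) = ∈-cartesianProductWith⁺ _∷_ {xs = false ∷ true ∷ []} (here refl)
                              (allWords-complete x)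
allWords-complete (true  ∷ x) = ∈-cartesianProductWith⁺ _∷_ {xs = false ∷ true ∷ []} (there (here refl))
                              (allWords-complete x)

differingBits : ∀ {n} → Word n → Word n → ℕ
differingBits {n} x y = count (λ i → ¬? (lookup x i ≟ᵇ lookup y i)) (allFin n)

private
  count-sym : ∀ {n m} (x y : Word n) (is : Vec (Fin n) m) →
              count (λ i → ¬? (lookup x i ≟ᵇ lookup y i)) is ≡
              count (λ i → ¬? (lookup y i ≟ᵇ lookup x i)) is
  count-sym x y []       = refl
  count-sym x y (i ∷ is) with lookup x i ≟ᵇ lookup y i | lookup y i ≟ᵇ lookup x i
  ... | yes _ | yes _ = count-sym x y is
  ... | no  _ | no  _ = cong suc (count-sym x y is)
  ... | yes p | no ¬q = contradiction (sym p) ¬q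
  ... | no ¬p | yes q = contradiction (sym q) ¬p

  count-refl : ∀ {n m} (x : Word n) (is : Vec (Fin n) m) →
               count (λ i → ¬? (lookup x i ≟ᵇ lookup x i)) is ≡ 0
  count-refl x []       = refl
  count-refl x (i ∷ is) with lookup x i ≟ᵇ lookup x i
  ... | yes _ = count-refl x is
  ... | no ¬p = contradiction refl ¬p

Q : ∀ n → FiniteGraph (Word n)
Q n = record
  { vertices = allWords n
  ; unique   = allWords-unique n
  ; _~_      = λ x y → differingBits x y ≡ 1
  ; _~?_     = λ x y → differingBits x y ≟ⁿ 1
  ; ~-sym    = λ {x} {y} p → trans (count-sym y x (allFin n)) p
  ; ~-irrefl = λ {x} p → contradiction (trans (sym (count-refl x (allFin n))) p) λ ()
  }

flipBit : ∀ {n} → Word n → Fin n → Word n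
flipBit x i = x [ i ]%= not

sensitivity : ∀ {n} → BoolFun n → Word n → ℕ
sensitivity {n} f x = count (λ i → ¬? (f x ≟ᵇ f (flipBit x i))) (allFin n)

SG¹ : ∀ {n} → ℕ → BoolFun n → FiniteGraph (Word n)
SG¹ {n} K f = inducedSubgraph (Q n) {P = λ x → sensitivity f x ≡ K × f x ≡ true}
  (λ x → (sensitivity f x ≟ⁿ K) ×-dec (f x ≟ᵇ true))

permuteBits : ∀ {n} → Permutation′ n → Word n → Word n
permuteBits π x = tabulate λ i → lookup x (π ⟨$⟩ʳ i)

-- Negates exactly the coordinates j at which c is true.
negateBits : ∀ {n} → Vec Bool n → Word n → Word n
negateBits c x = zipWith _xor_ c x

PNEquivalent : ∀ {n} → BoolFun n → BoolFun n → Set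
PNEquivalent {n} f g =
  Σ (Permutation′ n) λ π → Σ (Vec Bool n) λ c →
    ∀ (x : Word n) → f (permuteBits π (negateBits c x)) ≡ g x

{-# OPTIONS --safe #-}

-- x ↦ π ((¬) x) is an automorphism T of the hypercube Q_n with g = f ∘ T.
-- It turns a flip of bit π i into a flip of bit i, so it preserves sensitivity
-- and restricts to an isomorphism from the graph of g onto that of f.

module Submission where

open import Defs
open import Data.Bool.Base using (Bool; true; false; not; _xor_)
open import Data.Bool.Properties using (not-injective; not-involutive; not-distribʳ-xor)
open import Data.Fin.Base using (Fin; zero; suc)
open import Data.Fin.Permutation using (Permutation′; _⟨$⟩ʳ_; inverseˡ; inverseʳ; flip)
import Data.Fin.Properties as Fin
open import Data.List.Base as List using (List; []; _∷_; [_]; _++_; map; filter; length)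
open import Data.List.Membership.Propositional using (_∈_)
open import Data.List.Membership.Propositional.Properties using (∈-map⁺; ∈-allFin)
open import Data.List.Membership.Propositional.Properties.WithK using (unique∧set⇒bag)
open import Data.List.Properties
  using (filter-++; filter-≐; length-++; length-map; map-++; map-∘)
open import Data.List.Relation.Binary.BagAndSetEquality using (∼bag⇒↭)
open import Data.List.Relation.Binary.Permutation.Propositional
  using (_↭_; refl; prep; swap; trans; ↭-reflexive; ↭-trans)
open import Data.List.Relation.Binary.Permutation.Propositional.Properties
  using (filter-↭; ↭-length)
open import Data.List.Relation.Unary.Unique.Propositional using (Unique)
import Data.List.Relation.Unary.Unique.Propositional.Properties as Unique
open import Data.Nat.Base using (ℕ; zero; suc; _+_)
open import Data.Nat.Tactic.RingSolver using (solve-∀)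
open import Data.Product.Base as Product using (_×_; _,_; uncurry)
open import Data.Vec.Base as Vec using (Vec; []; _∷_; lookup; tabulate; count)
open import Data.Vec.Properties
  using (lookup∘tabulate; tabulate∘lookup; tabulate-cong; lookup-zipWith;
         lookup∘updateAt; lookup∘updateAt′)
open import Function.Base using (id; _∘_)
open import Function.Bundles using (_↔_; Inverse; mk⇔; mk↔ₛ′)
open import Function.Construct.Composition using (_↔-∘_)
open import Level using (0ℓ)
open import Relation.Binary.Core using (Rel)
import Relation.Binary.Definitions as B
open import Relation.Binary.PropositionalEquality as ≡
  using (_≡_; _≗_; refl; sym; cong; cong₂; subst; module ≡-Reasoning)
open import Relation.Nullary using (yes; no; does; contradiction)
open import Relation.Unary using (Pred; Decidable; _≐_)

private
  variable
    A B : Set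
    n : ℕ

-- Counting in lists

filter-map : {P : Pred B 0ℓ} (P? : Decidable P) (f : A → B) →
             filter P? ∘ map f ≗ map f ∘ filter (P? ∘ f)
filter-map P? f []       = refl
filter-map P? f (x ∷ xs) with does (P? (f x))
... | true  = cong (f x ∷_) (filter-map P? f xs)
... | false = filter-map P? f xs

length-filter-map : {P : Pred B 0ℓ} (P? : Decidable P) (f : A → B) (xs : List A) →
                    length (filter P? (map f xs)) ≡ length (filter (P? ∘ f) xs)
length-filter-map P? f xs =
  ≡.trans (cong length (filter-map P? f xs)) (length-map f (filter (P? ∘ f) xs))

length-filter-++ : {P : Pred A 0ℓ} (P? : Decidable P) (xs ys : List A) →
                   length (filter P? (xs ++ ys)) ≡ length (filter P? xs) + length (filter P? ys)
length-filter-++ P? xs ys =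
  ≡.trans (cong length (filter-++ P? xs ys)) (length-++ (filter P? xs))

Enumerates : List A → Set
Enumerates {A} xs = Unique xs × (∀ x → x ∈ xs)

-- Two complete lists have the same members. Absence of duplicates makes each membership proof
-- unique, so equality as sets upgrades to equality as bags, which is a permutation.
enumerations-↭ : {xs ys : List A} → Enumerates xs → Enumerates ys → xs ↭ ys
enumerations-↭ (xs! , ∈xs) (ys! , ∈ys) =
  ∼bag⇒↭ (unique∧set⇒bag xs! ys! (mk⇔ (λ _ → ∈ys _) (λ _ → ∈xs _)))

module _ (A↔B : A ↔ B) where
  open Inverse A↔B using (to; from; strictlyInverseˡ; strictlyInverseʳ)

  map-enumerates : {xs : List A} → Enumerates xs → Enumerates (map to xs)
  map-enumerates {xs} (xs! , ∈xs) =
    Unique.map⁺ to-injective xs! ,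
    λ y → subst (_∈ map to xs) (strictlyInverseˡ y) (∈-map⁺ to (∈xs (from y)))
    where
    to-injective : ∀ {x y} → to x ≡ to y → x ≡ y
    to-injective {x} {y} eq =
      ≡.trans (sym (strictlyInverseʳ x)) (≡.trans (cong from eq) (strictlyInverseʳ y))

  -- Filtering by `P` is filtering by `Q ∘ to`, which commutes with `map to`; and `map to xs` is
  -- again an enumeration, hence a reordering of `ys`. This serves twice: for the coordinates of a
  -- word and for the vertices of a sensitivity graph.
  filter-enumeration-↭ : {P : Pred A 0ℓ} {Q : Pred B 0ℓ} (P? : Decidable P) (Q? : Decidable Q) →
                         P ≐ Q ∘ to → {xs : List A} {ys : List B} →
                         Enumerates xs → Enumerates ys →
                         map to (filter P? xs) ↭ filter Q? ys
  filter-enumeration-↭ P? Q? P≐Q∘to {xs} exs eys = ↭-trans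
    (↭-reflexive (≡.trans (cong (map to) (filter-≐ P? (Q? ∘ to) P≐Q∘to xs))
                          (sym (filter-map Q? to xs))))
    (filter-↭ Q? (enumerations-↭ (map-enumerates exs) eys))

count-tabulate : {P : Pred A 0ℓ} (P? : Decidable P) (f : Fin n → A) →
                 count P? (tabulate f) ≡ length (filter P? (List.tabulate f))
count-tabulate {n = zero}  P? f = refl
count-tabulate {n = suc n} P? f with does (P? (f zero))
... | true  = cong suc (count-tabulate P? (f ∘ suc))
... | false = count-tabulate P? (f ∘ suc)

-- Re-indexing of a count along `π`. Once the counts are lengths of filtered lists, `π` carries the
-- indices satisfying `P` onto those satisfying `Q`, up to order.
count-permute : (π : Permutation′ n) {P Q : Pred (Fin n) 0ℓ} (P? : Decidable P) (Q? : Decidable Q) →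
                P ≐ Q ∘ (π ⟨$⟩ʳ_) → count P? (Vec.allFin n) ≡ count Q? (Vec.allFin n)
count-permute {n} π P? Q? P≐Q∘π = begin
  count P? (Vec.allFin n)                             ≡⟨ count-tabulate P? id ⟩
  length (filter P? (List.allFin n))                  ≡⟨ length-map (π ⟨$⟩ʳ_) (filter P? (List.allFin n)) ⟨
  length (map (π ⟨$⟩ʳ_) (filter P? (List.allFin n)))
    ≡⟨ ↭-length (filter-enumeration-↭ π P? Q? P≐Q∘π allFin-enumerates allFin-enumerates) ⟩
  length (filter Q? (List.allFin n))                  ≡⟨ count-tabulate Q? id ⟨
  count Q? (Vec.allFin n)                             ∎
  where
  open ≡-Reasoning
  allFin-enumerates : Enumerates (List.allFin n)
  allFin-enumerates = Unique.allFin⁺ n , ∈-allFin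

-- Counting edges

module _ {R : Rel A 0ℓ} (R? : B.Decidable R) where

  -- The edge count as a function of a bare vertex list, so that an induction on permutations can
  -- vary the list; at `vertices H` it unfolds to `∣E H ∣`.
  pairCount : List A → ℕ
  pairCount xs = length (filter (uncurry R?) (unorderedPairs xs))

  pairCount-∷ : ∀ x xs → pairCount (x ∷ xs) ≡ length (filter (R? x) xs) + pairCount xs
  pairCount-∷ x xs = ≡.trans
    (length-filter-++ (uncurry R?) (map (x ,_) xs) (unorderedPairs xs))
    (cong (_+ pairCount xs) (length-filter-map (uncurry R?) (x ,_) xs))

  -- Isolates the pair formed by the two heads, the one summand whose orientation changes when they
  -- are swapped.
  pairCount-∷∷ : ∀ x y xs → pairCount (x ∷ y ∷ xs) ≡
    (length (filter (R? x) [ y ]) + length (filter (R? x) xs)) +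
    (length (filter (R? y) xs) + pairCount xs)
  pairCount-∷∷ x y xs = ≡.trans (pairCount-∷ x (y ∷ xs))
    (cong₂ _+_ (length-filter-++ (R? x) [ y ] xs) (pairCount-∷ y xs))

  module _ (R-sym : B.Symmetric R) where

    length-filter-[]-sym : ∀ x y → length (filter (R? x) [ y ]) ≡ length (filter (R? y) [ x ])
    length-filter-[]-sym x y with R? x y | R? y x
    ... | yes _   | yes _   = refl
    ... | no  _   | no  _   = refl
    ... | yes xRy | no ¬yRx = contradiction (R-sym xRy) ¬yRx
    ... | no ¬xRy | yes yRx = contradiction (R-sym yRx) ¬xRy

    -- Each pair is listed in one orientation only, dictated by the order of the list, so reordering
    -- may reverse pairs. Induction on the permutation reduces this to adjacent swaps, where
    -- symmetry of `R` handles the single reversed pair.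
    pairCount-↭ : ∀ {xs ys} → xs ↭ ys → pairCount xs ≡ pairCount ys
    pairCount-↭ refl = refl
    pairCount-↭ {x ∷ xs} {_ ∷ ys} (prep x p) = begin
      pairCount (x ∷ xs)                          ≡⟨ pairCount-∷ x xs ⟩
      length (filter (R? x) xs) + pairCount xs
        ≡⟨ cong₂ _+_ (↭-length (filter-↭ (R? x) p)) (pairCount-↭ p) ⟩
      length (filter (R? x) ys) + pairCount ys    ≡⟨ pairCount-∷ x ys ⟨
      pairCount (x ∷ ys)                          ∎
      where open ≡-Reasoning
    pairCount-↭ {_ ∷ _ ∷ xs} {_ ∷ _ ∷ ys} (swap x y p) = begin
      pairCount (x ∷ y ∷ xs)
        ≡⟨ pairCount-∷∷ x y xs ⟩
      (length (filter (R? x) [ y ]) + length (filter (R? x) xs)) +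
      (length (filter (R? y) xs) + pairCount xs)
        ≡⟨ cong₂ _+_
             (cong₂ _+_ (length-filter-[]-sym x y) (↭-length (filter-↭ (R? x) p)))
             (cong₂ _+_ (↭-length (filter-↭ (R? y) p)) (pairCount-↭ p)) ⟩
      (length (filter (R? y) [ x ]) + length (filter (R? x) ys)) +
      (length (filter (R? y) ys) + pairCount ys)
        -- The contributions of `x` and of `y` against the tail trade places.
        ≡⟨ rearrange (length (filter (R? y) [ x ])) _ _ _ ⟩
      (length (filter (R? y) [ x ]) + length (filter (R? y) ys)) +
      (length (filter (R? x) ys) + pairCount ys)
        ≡⟨ pairCount-∷∷ y x ys ⟨
      pairCount (y ∷ x ∷ ys) ∎
      where
      open ≡-Reasoning
      rearrange : ∀ a b c d → (a + b) + (c + d) ≡ (a + c) + (b + d)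
      rearrange = solve-∀
    pairCount-↭ (trans p q) = ≡.trans (pairCount-↭ p) (pairCount-↭ q)

unorderedPairs-map : (f : A → B) (xs : List A) →
                     unorderedPairs (map f xs) ≡ map (Product.map f f) (unorderedPairs xs)
unorderedPairs-map f []       = refl
unorderedPairs-map f (x ∷ xs) = begin
  map (f x ,_) (map f xs) ++ unorderedPairs (map f xs)
    ≡⟨ cong₂ _++_ (≡.trans (sym (map-∘ xs)) (map-∘ xs)) (unorderedPairs-map f xs) ⟩
  map (Product.map f f) (map (x ,_) xs) ++ map (Product.map f f) (unorderedPairs xs)
    ≡⟨ map-++ (Product.map f f) (map (x ,_) xs) (unorderedPairs xs) ⟨
  map (Product.map f f) (map (x ,_) xs ++ unorderedPairs xs) ∎
  where open ≡-Reasoning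

open FiniteGraph

-- Adjacency in `G` is adjacency in `H` pulled back along `f`, so the edges of `G` are counted by
-- the pairs from `map f (vertices G)`; this list may then be reordered into `vertices H`.
∣E∣-iso : (G : FiniteGraph A) (H : FiniteGraph B) (f : A → B) →
          map f (vertices G) ↭ vertices H →
          (∀ {x y} → _~_ G x y → _~_ H (f x) (f y)) →
          (∀ {x y} → _~_ H (f x) (f y) → _~_ G x y) →
          ∣E G ∣ ≡ ∣E H ∣
∣E∣-iso G H f p preserves reflects = begin
  length (filter (uncurry (_~?_ G)) (unorderedPairs (vertices G)))
    ≡⟨ cong length (filter-≐ _ (uncurry (_~?_ H) ∘ Product.map f f)
         (preserves , reflects) (unorderedPairs (vertices G))) ⟩
  length (filter (uncurry (_~?_ H) ∘ Product.map f f) (unorderedPairs (vertices G)))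
    ≡⟨ length-filter-map (uncurry (_~?_ H)) (Product.map f f) (unorderedPairs (vertices G)) ⟨
  length (filter (uncurry (_~?_ H)) (map (Product.map f f) (unorderedPairs (vertices G))))
    ≡⟨ cong (length ∘ filter (uncurry (_~?_ H))) (unorderedPairs-map f (vertices G)) ⟨
  pairCount (_~?_ H) (map f (vertices G))
    ≡⟨ pairCount-↭ (_~?_ H) (~-sym H) p ⟩
  pairCount (_~?_ H) (vertices H) ∎
  where open ≡-Reasoning

-- Hypercube automorphisms

lookup-extensional : {xs ys : Vec A n} → lookup xs ≗ lookup ys → xs ≡ ys
lookup-extensional {xs = xs} {ys} eq =
  ≡.trans (sym (tabulate∘lookup xs)) (≡.trans (tabulate-cong eq) (tabulate∘lookup ys))

lookup-permuteBits : (π : Permutation′ n) (x : Word n) (i : Fin n) →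
                     lookup (permuteBits π x) i ≡ lookup x (π ⟨$⟩ʳ i)
lookup-permuteBits π x = lookup∘tabulate (λ i → lookup x (π ⟨$⟩ʳ i))

permuteBits-↔ : Permutation′ n → Word n ↔ Word n
permuteBits-↔ π = mk↔ₛ′ (permuteBits π) (permuteBits (flip π))
  (λ x → lookup-extensional λ i → ≡.trans (lookup-permuteBits π (permuteBits (flip π) x) i)
    (≡.trans (lookup-permuteBits (flip π) x _) (cong (lookup x) (inverseˡ π))))
  (λ x → lookup-extensional λ i → ≡.trans (lookup-permuteBits (flip π) (permuteBits π x) i)
    (≡.trans (lookup-permuteBits π x _) (cong (lookup x) (inverseʳ π))))

xor-involutiveˡ : ∀ a b → a xor (a xor b) ≡ b
xor-involutiveˡ false b = refl
xor-involutiveˡ true  b = not-involutive b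

xor-cancelˡ : ∀ a {b c} → a xor b ≡ a xor c → b ≡ c
xor-cancelˡ false eq = eq
xor-cancelˡ true  eq = not-injective eq

negateBits-involutive : (c x : Word n) → negateBits c (negateBits c x) ≡ x
negateBits-involutive []      []      = refl
negateBits-involutive (a ∷ c) (b ∷ x) = cong₂ _∷_ (xor-involutiveˡ a b) (negateBits-involutive c x)

negateBits-↔ : Word n → Word n ↔ Word n
negateBits-↔ c = mk↔ₛ′ (negateBits c) (negateBits c) (negateBits-involutive c) (negateBits-involutive c)

flipBit-negateBits : (c x : Word n) (i : Fin n) →
                     flipBit (negateBits c x) i ≡ negateBits c (flipBit x i)
flipBit-negateBits (a ∷ c) (b ∷ x) zero    = cong (_∷ negateBits c x) (not-distribʳ-xor a b)
flipBit-negateBits (a ∷ c) (b ∷ x) (suc i) = cong ((a xor b) ∷_) (flipBit-negateBits c x i)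

-- Bit `i` of the permuted word is read from position `π i`, so that is the position to flip
-- beforehand.
flipBit-permuteBits : (π : Permutation′ n) (x : Word n) (i : Fin n) →
                      flipBit (permuteBits π x) i ≡ permuteBits π (flipBit x (π ⟨$⟩ʳ i))
flipBit-permuteBits π x i = lookup-extensional λ j →
  ≡.trans (bit j) (sym (lookup-permuteBits π (flipBit x (π ⟨$⟩ʳ i)) j))
  where
  π-injective : ∀ {j k} → π ⟨$⟩ʳ j ≡ π ⟨$⟩ʳ k → j ≡ k
  π-injective eq = ≡.trans (sym (inverseˡ π)) (≡.trans (cong (Inverse.from π) eq) (inverseˡ π))
  bit : ∀ j → lookup (flipBit (permuteBits π x) i) j ≡ lookup (flipBit x (π ⟨$⟩ʳ i)) (π ⟨$⟩ʳ j)
  bit j with j Fin.≟ i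
  ... | yes refl = ≡.trans (lookup∘updateAt i (permuteBits π x))
    (≡.trans (cong not (lookup-permuteBits π x i)) (sym (lookup∘updateAt (π ⟨$⟩ʳ i) x)))
  -- Injectivity of `π` keeps `π j` away from the flipped position `π i`, so both sides read an
  -- unflipped bit.
  ... | no j≢i = ≡.trans (lookup∘updateAt′ j i j≢i (permuteBits π x))
    (≡.trans (lookup-permuteBits π x j)
             (sym (lookup∘updateAt′ (π ⟨$⟩ʳ j) (π ⟨$⟩ʳ i) (j≢i ∘ π-injective) x)))

-- The automorphism given by a PN-equivalence and its action on sensitivity graphs

module _ (π : Permutation′ n) (c : Word n) where

  private
    -- Negation is applied first, as in `PNEquivalent`; the forward map is then `T` by definition.
    T-↔ : Word n ↔ Word n
    T-↔ = permuteBits-↔ π ↔-∘ negateBits-↔ c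

    T : Word n → Word n
    T x = permuteBits π (negateBits c x)

  flipBit-automorphism : ∀ x i → flipBit (T x) i ≡ T (flipBit x (π ⟨$⟩ʳ i))
  flipBit-automorphism x i = ≡.trans (flipBit-permuteBits π (negateBits c x) i)
    (cong (permuteBits π) (flipBit-negateBits c x (π ⟨$⟩ʳ i)))

  lookup-automorphism : ∀ x i → lookup (T x) i ≡ lookup c (π ⟨$⟩ʳ i) xor lookup x (π ⟨$⟩ʳ i)
  lookup-automorphism x i = ≡.trans (lookup-permuteBits π (negateBits c x) i)
    (lookup-zipWith _xor_ (π ⟨$⟩ʳ i) c x)

  -- At position `i` both images are xored with the same bit of `c`, which cancels: they differ
  -- there exactly when `x` and `y` differ at `π i`.
  differingBits-automorphism : ∀ x y → differingBits (T x) (T y) ≡ differingBits x y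
  differingBits-automorphism x y = count-permute π _ _
    ( (λ {i} Tx≢Ty eq → Tx≢Ty (≡.trans (lookup-automorphism x i)
        (≡.trans (cong (lookup c (π ⟨$⟩ʳ i) xor_) eq) (sym (lookup-automorphism y i)))))
    , (λ {i} x≢y eq → x≢y (xor-cancelˡ (lookup c (π ⟨$⟩ʳ i))
        (≡.trans (sym (lookup-automorphism x i)) (≡.trans eq (lookup-automorphism y i))))))

  module _ {f g : BoolFun n} (f∘T≗g : ∀ x → f (T x) ≡ g x) where

    -- Flipping bit `i` of `T x` changes `f` exactly when flipping bit `π i` of `x` changes `g`, so
    -- the two counts agree after re-indexing by `π`.
    sensitivity-automorphism : ∀ x → sensitivity f (T x) ≡ sensitivity g x
    sensitivity-automorphism x = count-permute π _ _
      ( (λ {i} f≢ eq → f≢ (≡.trans (f∘T≗g x) (≡.trans eq (sym (f-flip i)))))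
      , (λ {i} g≢ eq → g≢ (≡.trans (sym (f∘T≗g x)) (≡.trans eq (f-flip i)))))
      where
      f-flip : ∀ i → f (flipBit (T x) i) ≡ g (flipBit x (π ⟨$⟩ʳ i))
      f-flip i = ≡.trans (cong f (flipBit-automorphism x i)) (f∘T≗g (flipBit x (π ⟨$⟩ʳ i)))

    ∣E-SG¹∣-automorphism : ∀ K → ∣E SG¹ K g ∣ ≡ ∣E SG¹ K f ∣
    ∣E-SG¹∣-automorphism K = ∣E∣-iso (SG¹ K g) (SG¹ K f) T
      (filter-enumeration-↭ T-↔ _ _
        ( (λ {x} → Product.map (≡.trans (sensitivity-automorphism x)) (≡.trans (f∘T≗g x)))
        , (λ {x} → Product.map (≡.trans (sym (sensitivity-automorphism x))) (≡.trans (sym (f∘T≗g x)))))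
        allWords-enumerates allWords-enumerates)
      -- Adjacency means that `differingBits` equals 1, so its invariance under `T` yields both
      -- preservation and reflection.
      (λ {x} {y} → ≡.trans (differingBits-automorphism x y))
      (λ {x} {y} → ≡.trans (sym (differingBits-automorphism x y)))
      where
      allWords-enumerates : Enumerates (allWords n)
      allWords-enumerates = allWords-unique n , allWords-complete

mainTheorem6 : ∀ (n : ℕ) (f g : BoolFun n) (K : ℕ) → PNEquivalent f g → ∣E SG¹ K f ∣ ≡ ∣E SG¹ K g ∣
mainTheorem6 n f g K (π , c , f∘T≗g) = sym (∣E-SG¹∣-automorphism π c f∘T≗g K)
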